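{- Let $x$ be a speedable number which is nearly computable. Then $x$ is regainingly approximable.
   Context: A left-computable real $x$ (i.e. limit of a computable non-decreasing sequence of rationals) is speedable if there exist $\rho\in(0,1)$ and a computable strictly increasing sequence of rationals $(x_n)_n$ converging to $x$ such that $\frac{x-x_{n+1}}{x-x_n}\le\rho$ for infinitely many $n\in\mathbb{N}$. A real $x$ is regainingly approximable if there is a computable non-decreasing sequence of rationals $(x_n)_n$ converging to $x$ with $x - x_n < 2^{ -n}$ for infinitely many $n\in\mathbb{N}$. A function $f:\mathbb{N}\to\mathbb{N}$ is a modulus of convergence of a convergent sequence $(y_n)_n$ with limit $y$ if for all $n$ and all $m\ge f(n)$ we have $|y-y_m|<2^{ -n}$; $(y_n)_n$ converges computably if it has a computable modulus of convergence. A sequence $(x_n)_n$ converges nearly computably if it converges and for every computable increasing function $s:\mathbb{N}\to\mathbb{N}$ the sequence $(x_{s(n+1)}-x_{s(n)})_n$ converges computably to $0$. A real is nearly computable if some computable sequence of rationals converges nearly computably to it. -}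

module Defs where

open import Data.Nat as ℕ using (ℕ; zero; suc)
import Data.Nat.Properties as ℕ
open import Data.Fin using (Fin)
open import Data.Integer using (+_; _⊖_)
open import Data.Vec using (Vec; []; _∷_; lookup)
open import Data.Product using (Σ-syntax; ∃-syntax; _×_; _,_)
open import Data.Rational as ℚ using (ℚ; 0ℚ; 1ℚ; ½; 1/_)
import Data.Rational.Properties as ℚ
open import Data.Rational.Solver using (module +-*-Solver)
open import Relation.Nullary using (¬_; yes; no; contradiction)
open import Relation.Binary.PropositionalEquality using (_≡_; refl; sym; trans; cong; cong₂; subst; subst₂)

-- Programs for the partial recursive (μ-recursive) functions.
data Rec : ℕ → Set where
  zer  : Rec 0
  succ : Rec 1
  proj : ∀ {n} → Fin n → Rec n
  comp : ∀ {k n} → Rec k → Vec (Rec n) k → Rec n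
  prec : ∀ {n} → Rec n → Rec (2 ℕ.+ n) → Rec (1 ℕ.+ n)
  mu   : ∀ {n} → Rec (1 ℕ.+ n) → Rec n

infix 4 _[_]⇓_ _[_]⇓*_

-- e [ xs ]⇓ y : the program e halts on input xs with output y. In prec and
-- mu the recursion (resp. search) variable is the first argument.
mutual
  data _[_]⇓_ : ∀ {n} → Rec n → Vec ℕ n → ℕ → Set where
    zer⇓   : zer [ [] ]⇓ 0
    succ⇓  : ∀ {x} → succ [ x ∷ [] ]⇓ suc x
    proj⇓  : ∀ {n} {i : Fin n} {xs} → proj i [ xs ]⇓ lookup xs i
    comp⇓  : ∀ {k n} {f : Rec k} {gs : Vec (Rec n) k} {xs ys z} →
             gs [ xs ]⇓* ys → f [ ys ]⇓ z → comp f gs [ xs ]⇓ z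
    prec⇓₀ : ∀ {n} {f : Rec n} {g xs y} →
             f [ xs ]⇓ y → prec f g [ 0 ∷ xs ]⇓ y
    prec⇓₊ : ∀ {n} {f : Rec n} {g xs m y z} →
             prec f g [ m ∷ xs ]⇓ y → g [ m ∷ y ∷ xs ]⇓ z →
             prec f g [ suc m ∷ xs ]⇓ z
    mu⇓    : ∀ {n} {f : Rec (1 ℕ.+ n)} {xs y} →
             (∀ z → z ℕ.< y → ∃[ w ] f [ z ∷ xs ]⇓ suc w) →
             f [ y ∷ xs ]⇓ 0 → mu f [ xs ]⇓ y

  data _[_]⇓*_ {n} : ∀ {k} → Vec (Rec n) k → Vec ℕ n → Vec ℕ k → Set where
    []⇓ : ∀ {xs} → [] [ xs ]⇓* []
    _∷⇓_ : ∀ {k} {g : Rec n} {gs : Vec (Rec n) k} {xs y ys} →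
           g [ xs ]⇓ y → gs [ xs ]⇓* ys → (g ∷ gs) [ xs ]⇓* (y ∷ ys)

Computable : (ℕ → ℕ) → Set
Computable f = Σ[ e ∈ Rec 1 ] (∀ n → e [ n ∷ [] ]⇓ f n)

Computableℚ : (ℕ → ℚ) → Set
Computableℚ x =
  Σ[ a ∈ (ℕ → ℕ) ] Σ[ b ∈ (ℕ → ℕ) ] Σ[ c ∈ (ℕ → ℕ) ]
    Computable a × Computable b × Computable c ×
    (∀ n → x n ≡ (a n ⊖ b n) ℚ./ suc (c n))

module ℚ-Facts where
  half-pos : ∀ {ε} → 0ℚ ℚ.< ε → 0ℚ ℚ.< ½ ℚ.* ε
  half-pos {ε} p = subst (ℚ._< ½ ℚ.* ε) (ℚ.*-zeroʳ ½) (ℚ.*-monoʳ-<-pos ½ p)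

  half+half : ∀ ε → ½ ℚ.* ε ℚ.+ ½ ℚ.* ε ≡ ε
  half+half ε = trans (sym (ℚ.*-distribʳ-+ ε ½ ½)) (ℚ.*-identityˡ ε)

  *-pos : ∀ {p q} → 0ℚ ℚ.< p → 0ℚ ℚ.< q → 0ℚ ℚ.< p ℚ.* q
  *-pos {p} {q} 0<p 0<q =
    ℚ.positive⁻¹ _ {{ℚ.pos*pos⇒pos p {{ℚ.positive 0<p}} q {{ℚ.positive 0<q}}}}

  recip⁺ : ∀ {K} → 0ℚ ℚ.< K → Σ[ L ∈ ℚ ] (0ℚ ℚ.< L × L ℚ.* K ≡ 1ℚ)
  recip⁺ {K} 0<K =
    (1/ K) {{ℚ.pos⇒nonZero K {{ℚ.positive 0<K}}}}
    , ℚ.positive⁻¹ _ {{ℚ.1/pos⇒pos K {{ℚ.positive 0<K}}}}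
    , ℚ.*-inverseˡ K {{ℚ.pos⇒nonZero K {{ℚ.positive 0<K}}}}

  -- t ≤ K and s < η / K give t s < η.
  scale : ∀ t K L s η → 0ℚ ℚ.< K → L ℚ.* K ≡ 1ℚ → t ℚ.≤ K → 0ℚ ℚ.≤ s →
          s ℚ.< η ℚ.* L → t ℚ.* s ℚ.< η
  scale t K L s η 0<K LK t≤K 0≤s s<ηL = ℚ.≤-<-trans
    (ℚ.*-monoʳ-≤-nonNeg s {{ℚ.nonNegative 0≤s}} t≤K)
    (subst₂ ℚ._<_ (ℚ.*-comm s K)
      (trans (ℚ.*-assoc η L K) (trans (cong (η ℚ.*_) LK) (ℚ.*-identityʳ η)))
      (ℚ.*-monoˡ-<-pos K {{ℚ.positive 0<K}} s<ηL))

  ∣-∣-comm : ∀ p q → ℚ.∣ p ℚ.- q ∣ ≡ ℚ.∣ q ℚ.- p ∣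
  ∣-∣-comm p q = trans (cong ℚ.∣_∣ (solve 2 (λ p q → p :- q := :- (q :- p)) refl p q))
                       (ℚ.∣-p∣≡∣p∣ (q ℚ.- p))
    where open +-*-Solver

  ≤∣∣ : ∀ p → p ℚ.≤ ℚ.∣ p ∣
  ≤∣∣ p with 0ℚ ℚ.≤? p
  ... | yes 0≤p = ℚ.≤-reflexive (sym (ℚ.0≤p⇒∣p∣≡p 0≤p))
  ... | no  0≰p = ℚ.≤-trans (ℚ.<⇒≤ (ℚ.≰⇒> 0≰p)) (ℚ.0≤∣p∣ p)

  ∣p∣≤∣q∣+∣p-q∣ : ∀ p q → ℚ.∣ p ∣ ℚ.≤ ℚ.∣ q ∣ ℚ.+ ℚ.∣ p ℚ.- q ∣
  ∣p∣≤∣q∣+∣p-q∣ p q = subst (λ r → ℚ.∣ r ∣ ℚ.≤ ℚ.∣ q ∣ ℚ.+ ℚ.∣ p ℚ.- q ∣)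
    (solve 2 (λ p q → q :+ (p :- q) := p) refl p q) (ℚ.∣p+q∣≤∣p∣+∣q∣ q (p ℚ.- q))
    where open +-*-Solver

  ∣p∣-∣q∣≤∣p-q∣ : ∀ p q → ℚ.∣ p ∣ ℚ.- ℚ.∣ q ∣ ℚ.≤ ℚ.∣ p ℚ.- q ∣
  ∣p∣-∣q∣≤∣p-q∣ p q = subst (ℚ.∣ p ∣ ℚ.- ℚ.∣ q ∣ ℚ.≤_)
    (solve 2 (λ a b → a :+ b :- a := b) refl ℚ.∣ q ∣ ℚ.∣ p ℚ.- q ∣)
    (ℚ.+-monoˡ-≤ (ℚ.- ℚ.∣ q ∣) (∣p∣≤∣q∣+∣p-q∣ p q))
    where open +-*-Solver

  ∣∣p∣-∣q∣∣≤∣p-q∣ : ∀ p q → ℚ.∣ ℚ.∣ p ∣ ℚ.- ℚ.∣ q ∣ ∣ ℚ.≤ ℚ.∣ p ℚ.- q ∣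
  ∣∣p∣-∣q∣∣≤∣p-q∣ p q with 0ℚ ℚ.≤? ℚ.∣ p ∣ ℚ.- ℚ.∣ q ∣
  ... | yes 0≤d = subst (ℚ._≤ ℚ.∣ p ℚ.- q ∣) (sym (ℚ.0≤p⇒∣p∣≡p 0≤d)) (∣p∣-∣q∣≤∣p-q∣ p q)
  ... | no  0≰d = subst₂ ℚ._≤_ eq (∣-∣-comm q p) (∣p∣-∣q∣≤∣p-q∣ q p)
    where
    open +-*-Solver
    d = ℚ.∣ p ∣ ℚ.- ℚ.∣ q ∣
    -d≡ : ℚ.- d ≡ ℚ.∣ q ∣ ℚ.- ℚ.∣ p ∣
    -d≡ = solve 2 (λ a b → :- (a :- b) := b :- a) refl ℚ.∣ p ∣ ℚ.∣ q ∣
    eq : ℚ.∣ q ∣ ℚ.- ℚ.∣ p ∣ ≡ ℚ.∣ d ∣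
    eq = trans (sym -d≡) (trans
      (sym (ℚ.0≤p⇒∣p∣≡p (ℚ.<⇒≤ (ℚ.neg-antimono-< (ℚ.≰⇒> 0≰d)))))
      (ℚ.∣-p∣≡∣p∣ d))

  module Identities where
    open +-*-Solver

    sub-sub : ∀ a b c d → (a ℚ.- c) ℚ.- (b ℚ.- d) ≡ (a ℚ.- b) ℚ.- (c ℚ.- d)
    sub-sub = solve 4 (λ a b c d → (a :- c) :- (b :- d) := (a :- b) :- (c :- d)) refl

    mul-sub : ∀ a b c d → a ℚ.* (b ℚ.- d) ℚ.+ d ℚ.* (a ℚ.- c) ≡ a ℚ.* b ℚ.- c ℚ.* d
    mul-sub = solve 4 (λ a b c d → a :* (b :- d) :+ d :* (a :- c) := a :* b :- c :* d) refl

    swap : ∀ u D a → u ℚ.* (D ℚ.* a) ≡ D ℚ.* (u ℚ.* a)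
    swap = solve 3 (λ u D a → u :* (D :* a) := D :* (u :* a)) refl

    inv-sub : ∀ u v a b → u ℚ.* v ℚ.* (b ℚ.- a) ≡ u ℚ.* (v ℚ.* b) ℚ.- v ℚ.* (u ℚ.* a)
    inv-sub = solve 4 (λ u v a b → u :* v :* (b :- a) := u :* (v :* b) :- v :* (u :* a)) refl

    cancel₁ : ∀ a b c ε → (c ℚ.+ ((b ℚ.- a) ℚ.+ ε)) ℚ.+ (a ℚ.- b ℚ.- c) ≡ 0ℚ ℚ.+ ε
    cancel₁ = solve 4 (λ a b c ε → (c :+ (b :- a :+ ε)) :+ (a :- b :- c) := con 0ℚ :+ ε) refl

    cancel₂ : ∀ a b c e → (b ℚ.+ (c ℚ.- e)) ℚ.+ (a ℚ.- b ℚ.- c) ≡ a ℚ.- e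
    cancel₂ = solve 4 (λ a b c e → (b :+ (c :- e)) :+ (a :- b :- c) := a :- e) refl

open ℚ-Facts

IsCauchy : (ℕ → ℚ) → Set
IsCauchy x = ∀ ε → 0ℚ ℚ.< ε →
  ∃[ N ] (∀ m n → N ℕ.≤ m → N ℕ.≤ n → ℚ.∣ x m ℚ.- x n ∣ ℚ.< ε)

-- Real numbers are Cauchy sequences of rationals; distinct sequences may
-- represent the same real, and all relations below respect this.
record ℝ : Set where
  constructor mkℝ
  field
    seq    : ℕ → ℚ
    cauchy : IsCauchy seq

open ℝ public

infix 4 _<ᵣ_ _≤ᵣ_
infixl 6 _-ᵣ_
infixl 7 _*ᵣ_

_<ᵣ_ : ℝ → ℝ → Set
x <ᵣ y = Σ[ ε ∈ ℚ ] (0ℚ ℚ.< ε × ∃[ N ] (∀ n → N ℕ.≤ n → seq x n ℚ.+ ε ℚ.≤ seq y n))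

_≤ᵣ_ : ℝ → ℝ → Set
x ≤ᵣ y = ¬ (y <ᵣ x)

fromℚ : ℚ → ℝ
fromℚ q = mkℝ (λ _ → q) λ ε 0<ε →
  0 , λ _ _ _ _ → subst (λ r → ℚ.∣ r ∣ ℚ.< ε) (sym (ℚ.+-inverseʳ q)) 0<ε

0ᵣ : ℝ
0ᵣ = fromℚ 0ℚ

1ᵣ : ℝ
1ᵣ = fromℚ 1ℚ

_-ᵣ_ : ℝ → ℝ → ℝ
x -ᵣ y = mkℝ (λ n → seq x n ℚ.- seq y n) isCauchy
  where
  isCauchy : IsCauchy (λ n → seq x n ℚ.- seq y n)
  isCauchy ε 0<ε with cauchy x (½ ℚ.* ε) (half-pos 0<ε) | cauchy y (½ ℚ.* ε) (half-pos 0<ε)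
  ... | M , p | N , q = M ℕ.⊔ N , λ m n ≤m ≤n →
    let a = seq x m ; b = seq y m ; c = seq x n ; d = seq y n in
    ℚ.≤-<-trans
      (subst (λ r → ℚ.∣ r ∣ ℚ.≤ ℚ.∣ a ℚ.- c ∣ ℚ.+ ℚ.∣ b ℚ.- d ∣)
        (Identities.sub-sub a b c d)
        (ℚ.∣p-q∣≤∣p∣+∣q∣ (a ℚ.- c) (b ℚ.- d)))
      (subst (ℚ.∣ a ℚ.- c ∣ ℚ.+ ℚ.∣ b ℚ.- d ∣ ℚ.<_) (half+half ε)
        (ℚ.+-mono-<
          (p m n (ℕ.≤-trans (ℕ.m≤m⊔n M N) ≤m) (ℕ.≤-trans (ℕ.m≤m⊔n M N) ≤n))
          (q m n (ℕ.≤-trans (ℕ.m≤n⊔m M N) ≤m) (ℕ.≤-trans (ℕ.m≤n⊔m M N) ≤n))))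

∣_∣ᵣ : ℝ → ℝ
∣ x ∣ᵣ = mkℝ (λ n → ℚ.∣ seq x n ∣) isCauchy
  where
  isCauchy : IsCauchy (λ n → ℚ.∣ seq x n ∣)
  isCauchy ε 0<ε with cauchy x ε 0<ε
  ... | N , p = N , λ m n ≤m ≤n →
    ℚ.≤-<-trans (∣∣p∣-∣q∣∣≤∣p-q∣ (seq x m) (seq x n)) (p m n ≤m ≤n)

bounded : ∀ x → Σ[ K ∈ ℚ ] (0ℚ ℚ.< K × ∃[ N ] (∀ n → N ℕ.≤ n → ℚ.∣ seq x n ∣ ℚ.≤ K))
bounded x with cauchy x 1ℚ (ℚ.positive⁻¹ 1ℚ)
... | N , p = ℚ.∣ seq x N ∣ ℚ.+ 1ℚ
  , ℚ.+-mono-≤-< (ℚ.0≤∣p∣ (seq x N)) (ℚ.positive⁻¹ 1ℚ)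
  , N , λ n ≤n → ℚ.≤-trans (∣p∣≤∣q∣+∣p-q∣ (seq x n) (seq x N))
      (ℚ.+-monoʳ-≤ ℚ.∣ seq x N ∣ (ℚ.<⇒≤ (p n N ≤n ℕ.≤-refl)))

mul-close : ∀ a b c d A A⁻¹ B B⁻¹ ε →
  0ℚ ℚ.< A → A⁻¹ ℚ.* A ≡ 1ℚ → 0ℚ ℚ.< B → B⁻¹ ℚ.* B ≡ 1ℚ →
  ℚ.∣ a ∣ ℚ.≤ A → ℚ.∣ d ∣ ℚ.≤ B →
  ℚ.∣ a ℚ.- c ∣ ℚ.< ½ ℚ.* ε ℚ.* B⁻¹ → ℚ.∣ b ℚ.- d ∣ ℚ.< ½ ℚ.* ε ℚ.* A⁻¹ →
  ℚ.∣ a ℚ.* b ℚ.- c ℚ.* d ∣ ℚ.< ε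
mul-close a b c d A A⁻¹ B B⁻¹ ε 0<A A⁻¹A 0<B B⁻¹B a≤A d≤B ac bd =
  subst (λ r → ℚ.∣ r ∣ ℚ.< ε) (Identities.mul-sub a b c d)
    (ℚ.≤-<-trans (ℚ.∣p+q∣≤∣p∣+∣q∣ (a ℚ.* (b ℚ.- d)) (d ℚ.* (a ℚ.- c)))
      (subst₂ ℚ._<_
        (sym (cong₂ ℚ._+_ (ℚ.∣p*q∣≡∣p∣*∣q∣ a (b ℚ.- d)) (ℚ.∣p*q∣≡∣p∣*∣q∣ d (a ℚ.- c))))
        (half+half ε)
        (ℚ.+-mono-<
          (scale ℚ.∣ a ∣ A A⁻¹ ℚ.∣ b ℚ.- d ∣ (½ ℚ.* ε) 0<A A⁻¹A a≤A (ℚ.0≤∣p∣ (b ℚ.- d)) bd)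
          (scale ℚ.∣ d ∣ B B⁻¹ ℚ.∣ a ℚ.- c ∣ (½ ℚ.* ε) 0<B B⁻¹B d≤B (ℚ.0≤∣p∣ (a ℚ.- c)) ac))))

_*ᵣ_ : ℝ → ℝ → ℝ
x *ᵣ y = mkℝ (λ n → seq x n ℚ.* seq y n) isCauchy
  where
  isCauchy : IsCauchy (λ n → seq x n ℚ.* seq y n)
  isCauchy ε 0<ε =
    let A , 0<A , N₁ , ≤A = bounded x
        B , 0<B , N₂ , ≤B = bounded y
        A⁻¹ , 0<A⁻¹ , A⁻¹A = recip⁺ 0<A
        B⁻¹ , 0<B⁻¹ , B⁻¹B = recip⁺ 0<B
        N₃ , p = cauchy x (½ ℚ.* ε ℚ.* B⁻¹) (*-pos (half-pos 0<ε) 0<B⁻¹)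
        N₄ , q = cauchy y (½ ℚ.* ε ℚ.* A⁻¹) (*-pos (half-pos 0<ε) 0<A⁻¹)
        M = N₁ ℕ.⊔ N₂
        N = N₃ ℕ.⊔ N₄
        N₁≤ = ℕ.≤-trans (ℕ.m≤m⊔n N₁ N₂) (ℕ.m≤m⊔n M N)
        N₂≤ = ℕ.≤-trans (ℕ.m≤n⊔m N₁ N₂) (ℕ.m≤m⊔n M N)
        N₃≤ = ℕ.≤-trans (ℕ.m≤m⊔n N₃ N₄) (ℕ.m≤n⊔m M N)
        N₄≤ = ℕ.≤-trans (ℕ.m≤n⊔m N₃ N₄) (ℕ.m≤n⊔m M N)
    in M ℕ.⊔ N , λ m n ≤m ≤n →
      mul-close (seq x m) (seq y m) (seq x n) (seq y n) A A⁻¹ B B⁻¹ ε 0<A A⁻¹A 0<B B⁻¹B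
        (≤A m (ℕ.≤-trans N₁≤ ≤m)) (≤B n (ℕ.≤-trans N₂≤ ≤n))
        (p m n (ℕ.≤-trans N₃≤ ≤m) (ℕ.≤-trans N₃≤ ≤n))
        (q m n (ℕ.≤-trans N₄≤ ≤m) (ℕ.≤-trans N₄≤ ≤n))

-- Total reciprocal; the value at 0 is irrelevant, since a positive real
-- has only finitely many zero terms.
inv : ℚ → ℚ
inv q with q ℚ.≟ 0ℚ
... | yes _  = 0ℚ
... | no q≢0 = (1/ q) {{ℚ.≢-nonZero q≢0}}

inv-inverse : ∀ {q} → 0ℚ ℚ.< q → inv q ℚ.* q ≡ 1ℚ
inv-inverse {q} 0<q with q ℚ.≟ 0ℚ
... | yes refl = contradiction 0<q (ℚ.<-irrefl refl)
... | no q≢0   = ℚ.*-inverseˡ q {{ℚ.≢-nonZero q≢0}}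

inv-pos : ∀ {q} → 0ℚ ℚ.< q → 0ℚ ℚ.< inv q
inv-pos {q} 0<q with q ℚ.≟ 0ℚ
... | yes refl = contradiction 0<q (ℚ.<-irrefl refl)
... | no q≢0   = ℚ.positive⁻¹ _ {{ℚ.1/pos⇒pos q {{ℚ.positive 0<q}}}}

inv-≤ : ∀ {δ a D} → 0ℚ ℚ.< δ → 0ℚ ℚ.< D → D ℚ.* δ ≡ 1ℚ → δ ℚ.≤ a → inv a ℚ.≤ D
inv-≤ {δ} {a} {D} 0<δ 0<D Dδ δ≤a = subst₂ ℚ._≤_ lhs rhs
  (ℚ.*-monoˡ-≤-nonNeg u {{ℚ.nonNegative (ℚ.<⇒≤ (inv-pos 0<a))}}
    (ℚ.*-monoˡ-≤-nonNeg D {{ℚ.nonNegative (ℚ.<⇒≤ 0<D)}} δ≤a))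
  where
  u = inv a
  0<a = ℚ.<-≤-trans 0<δ δ≤a
  lhs : u ℚ.* (D ℚ.* δ) ≡ u
  lhs = trans (cong (u ℚ.*_) Dδ) (ℚ.*-identityʳ u)
  rhs : u ℚ.* (D ℚ.* a) ≡ D
  rhs = trans (Identities.swap u D a)
              (trans (cong (D ℚ.*_) (inv-inverse 0<a)) (ℚ.*-identityʳ D))

inv-diff : ∀ {a b} → 0ℚ ℚ.< a → 0ℚ ℚ.< b →
           inv a ℚ.- inv b ≡ inv a ℚ.* inv b ℚ.* (b ℚ.- a)
inv-diff {a} {b} 0<a 0<b = sym (trans
  (Identities.inv-sub (inv a) (inv b) a b)
  (cong₂ ℚ._-_
    (trans (cong (inv a ℚ.*_) (inv-inverse 0<b)) (ℚ.*-identityʳ (inv a)))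
    (trans (cong (inv b ℚ.*_) (inv-inverse 0<a)) (ℚ.*-identityʳ (inv b)))))

inv-close : ∀ a b δ D L ε → 0ℚ ℚ.< δ → 0ℚ ℚ.< D → D ℚ.* δ ≡ 1ℚ → L ℚ.* (D ℚ.* D) ≡ 1ℚ →
  δ ℚ.≤ a → δ ℚ.≤ b → ℚ.∣ b ℚ.- a ∣ ℚ.< ε ℚ.* L → ℚ.∣ inv a ℚ.- inv b ∣ ℚ.< ε
inv-close a b δ D L ε 0<δ 0<D Dδ LDD δ≤a δ≤b ba = subst (ℚ._< ε) (sym eq)
  (scale (inv a ℚ.* inv b) (D ℚ.* D) L ℚ.∣ b ℚ.- a ∣ ε (*-pos 0<D 0<D) LDD uv≤DD (ℚ.0≤∣p∣ (b ℚ.- a)) ba)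
  where
  0<a : 0ℚ ℚ.< a
  0<a = ℚ.<-≤-trans 0<δ δ≤a
  0<b : 0ℚ ℚ.< b
  0<b = ℚ.<-≤-trans 0<δ δ≤b
  uv≤DD : inv a ℚ.* inv b ℚ.≤ D ℚ.* D
  uv≤DD = ℚ.≤-trans
    (ℚ.*-monoʳ-≤-nonNeg (inv b) {{ℚ.nonNegative (ℚ.<⇒≤ (inv-pos 0<b))}} (inv-≤ 0<δ 0<D Dδ δ≤a))
    (ℚ.*-monoˡ-≤-nonNeg D {{ℚ.nonNegative (ℚ.<⇒≤ 0<D)}} (inv-≤ 0<δ 0<D Dδ δ≤b))
  eq : ℚ.∣ inv a ℚ.- inv b ∣ ≡ inv a ℚ.* inv b ℚ.* ℚ.∣ b ℚ.- a ∣
  eq = trans (cong ℚ.∣_∣ (inv-diff 0<a 0<b))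
    (trans (ℚ.∣p*q∣≡∣p∣*∣q∣ (inv a ℚ.* inv b) (b ℚ.- a))
           (cong (ℚ._* ℚ.∣ b ℚ.- a ∣) (ℚ.0≤p⇒∣p∣≡p (ℚ.<⇒≤ (*-pos (inv-pos 0<a) (inv-pos 0<b))))))

recip : (y : ℝ) → 0ᵣ <ᵣ y → ℝ
recip y (δ , 0<δ , M , δ≤) = mkℝ (λ n → inv (seq y n)) isCauchy
  where
  δ≤y : ∀ n → M ℕ.≤ n → δ ℚ.≤ seq y n
  δ≤y n M≤n = subst (ℚ._≤ seq y n) (ℚ.+-identityˡ δ) (δ≤ n M≤n)

  isCauchy : IsCauchy (λ n → inv (seq y n))
  isCauchy ε 0<ε =
    let D , 0<D , Dδ = recip⁺ 0<δ
        L , 0<L , LDD = recip⁺ (*-pos 0<D 0<D)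
        N , p = cauchy y (ε ℚ.* L) (*-pos 0<ε 0<L)
    in M ℕ.⊔ N , λ m n ≤m ≤n →
      inv-close (seq y m) (seq y n) δ D L ε 0<δ 0<D Dδ LDD
        (δ≤y m (ℕ.≤-trans (ℕ.m≤m⊔n M N) ≤m)) (δ≤y n (ℕ.≤-trans (ℕ.m≤m⊔n M N) ≤n))
        (p n m (ℕ.≤-trans (ℕ.m≤n⊔m M N) ≤n) (ℕ.≤-trans (ℕ.m≤n⊔m M N) ≤m))

divide : ℝ → (y : ℝ) → 0ᵣ <ᵣ y → ℝ
divide x y 0<y = x *ᵣ recip y 0<y

2^- : ℕ → ℝ
2^- n = fromℚ ((+ 1 ℚ./ (2 ℕ.^ n)) {{ℕ.m^n≢0 2 n}})

ConvergesTo : (ℕ → ℝ) → ℝ → Set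
ConvergesTo y l = ∀ (ε : ℝ) → 0ᵣ <ᵣ ε → ∃[ N ] (∀ n → N ℕ.≤ n → ∣ l -ᵣ y n ∣ᵣ <ᵣ ε)

IsModulus : (ℕ → ℕ) → (ℕ → ℝ) → ℝ → Set
IsModulus f y l = ∀ n m → f n ℕ.≤ m → ∣ l -ᵣ y m ∣ᵣ <ᵣ 2^- n

ConvergesComputablyTo : (ℕ → ℝ) → ℝ → Set
ConvergesComputablyTo y l =
  ConvergesTo y l × Σ[ f ∈ (ℕ → ℕ) ] (Computable f × IsModulus f y l)

⟦_⟧ : (ℕ → ℚ) → (ℕ → ℝ)
⟦ x ⟧ n = fromℚ (x n)

Increasing : (ℕ → ℕ) → Set
Increasing s = ∀ n → s n ℕ.< s (suc n)

ConvergesNearlyComputablyTo : (ℕ → ℚ) → ℝ → Set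
ConvergesNearlyComputablyTo x l =
  ConvergesTo ⟦ x ⟧ l ×
  (∀ s → Computable s → Increasing s →
    ConvergesComputablyTo ⟦ (λ n → x (s (suc n)) ℚ.- x (s n)) ⟧ 0ᵣ)

NonDecreasingℚ : (ℕ → ℚ) → Set
NonDecreasingℚ x = ∀ n → x n ℚ.≤ x (suc n)

StrictlyIncreasingℚ : (ℕ → ℚ) → Set
StrictlyIncreasingℚ x = ∀ n → x n ℚ.< x (suc n)

InfinitelyMany : (ℕ → Set) → Set
InfinitelyMany P = ∀ N → ∃[ n ] (N ℕ.≤ n × P n)

monotone : ∀ {x} → StrictlyIncreasingℚ x → ∀ m k → x m ℚ.≤ x (k ℕ.+ m)
monotone {x} inc m zero    = ℚ.≤-refl
monotone {x} inc m (suc k) = ℚ.≤-trans (monotone {x} inc m k) (ℚ.<⇒≤ (inc (k ℕ.+ m)))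

below-limit : ∀ a b c e ε → c ℚ.≤ b → ℚ.∣ a ℚ.- b ∣ ℚ.+ ε ℚ.≤ c ℚ.- e → 0ℚ ℚ.+ ε ℚ.≤ a ℚ.- e
below-limit a b c e ε c≤b h = subst₂ ℚ._≤_ (Identities.cancel₁ a b c ε) (Identities.cancel₂ a b c e)
  (ℚ.+-monoˡ-≤ (a ℚ.- b ℚ.- c) (ℚ.+-mono-≤ c≤b
    (ℚ.≤-trans (ℚ.+-monoˡ-≤ ε (subst ((b ℚ.- a) ℚ.≤_) (∣-∣-comm b a) (≤∣∣ (b ℚ.- a)))) h)))

-- Makes the quotient in Speedable well defined.
0<limit-term : ∀ x {l} → StrictlyIncreasingℚ x → ConvergesTo ⟦ x ⟧ l →
               ∀ n → 0ᵣ <ᵣ l -ᵣ fromℚ (x n)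
0<limit-term x {l} inc conv n =
  let N , close = conv (fromℚ d) (d , 0<d , 0 , λ _ _ → ℚ.≤-reflexive (ℚ.+-identityˡ d))
      ε , 0<ε , M , bound = close (N ℕ.+ suc n) (ℕ.m≤m+n N (suc n))
  in ε , 0<ε , M , λ k M≤k →
    below-limit (seq l k) (x (N ℕ.+ suc n)) (x (suc n)) (x n) ε
      (monotone {x} inc (suc n) N) (bound k M≤k)
  where
  d = x (suc n) ℚ.- x n
  0<d : 0ℚ ℚ.< d
  0<d = subst (ℚ._< d) (ℚ.+-inverseʳ (x n)) (ℚ.+-monoˡ-< (ℚ.- x n) (inc n))

LeftComputable : ℝ → Set
LeftComputable x =
  Σ[ xs ∈ (ℕ → ℚ) ] (Computableℚ xs × NonDecreasingℚ xs × ConvergesTo ⟦ xs ⟧ x)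

Speedable : ℝ → Set
Speedable x =
  LeftComputable x ×
  Σ[ ρ ∈ ℝ ] (0ᵣ <ᵣ ρ × ρ <ᵣ 1ᵣ ×
    Σ[ xs ∈ (ℕ → ℚ) ] (Computableℚ xs ×
      Σ[ inc ∈ StrictlyIncreasingℚ xs ] Σ[ conv ∈ ConvergesTo ⟦ xs ⟧ x ]
        InfinitelyMany (λ n →
          divide (x -ᵣ fromℚ (xs (suc n))) (x -ᵣ fromℚ (xs n)) (0<limit-term xs {x} inc conv n)
            ≤ᵣ ρ)))

RegaininglyApproximable : ℝ → Set
RegaininglyApproximable x =
  Σ[ xs ∈ (ℕ → ℚ) ] (Computableℚ xs × NonDecreasingℚ xs × ConvergesTo ⟦ xs ⟧ x ×
    InfinitelyMany (λ n → x -ᵣ fromℚ (xs n) <ᵣ 2^- n))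

NearlyComputable : ℝ → Set
NearlyComputable x =
  Σ[ xs ∈ (ℕ → ℚ) ] (Computableℚ xs × ConvergesNearlyComputablyTo xs x)

{-# OPTIONS --safe #-}
module Submission where

-- Let (x_n) be an increasing approximation witnessing speedability and (y_n) one
-- converging nearly computably to x. Searching for t(n+1) > t(n) with
-- |x_t − y_t| < 2^-n gives a computable increasing t along which the jumps
-- x_{t(n+1)} − x_{t(n)} tend to 0 computably, since those of y do. At a fast
-- stage m we have σ(x − x_m) ≤ x_{m+1} − x_m with σ ≤ 1 − ρ, so if t(n) ≤ m < t(n+1)
-- then x − x_m is at most 1/σ times the n-th jump, which is at most 3·2^-k as
-- soon as n ≥ F(k), for an increasing F majorising a modulus of the jumps of y.
-- With F(k) ≤ n < F(k+1) and 6·2^-c ≤ σ, the sequence z_j = x_{t(F(j+c+1))}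
-- therefore satisfies x − z_j < 2^-j at j = k − c.

open import Data.Nat as ℕ using (ℕ; zero; suc; NonZero)
import Data.Nat.Properties as ℕ
open import Data.Integer as ℤ using (+_; +[1+_]; _⊖_)
import Data.Integer.Properties as ℤ
import Data.Integer.Solver as ℤSolver
open import Data.Fin using (Fin)
open import Data.Fin.Patterns using (0F; 1F; 2F)
open import Data.Vec using (Vec; []; _∷_; lookup)
open import Data.Product using (Σ-syntax; ∃-syntax; _×_; _,_; proj₁; proj₂)
open import Data.Rational hiding (NonZero)
open import Data.Rational.Properties
open import Data.Rational.Solver using (module +-*-Solver)
open import Data.Rational.Unnormalised as ℚᵘ using (mkℚᵘ)
import Data.Rational.Unnormalised.Properties as ℚᵘ
open import Relation.Binary.PropositionalEquality using (_≡_; refl; sym; trans; cong; cong₂; subst; subst₂)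
open import Relation.Nullary using (yes; no; contradiction)
open import Defs
open ℚ-Facts

-- Computable functions

Computableⁿ : ∀ {n} → (Vec ℕ n → ℕ) → Set
Computableⁿ {n} F = Σ[ e ∈ Rec n ] (∀ xs → e [ xs ]⇓ F xs)

Computable₂ : (ℕ → ℕ → ℕ) → Set
Computable₂ f = Σ[ e ∈ Rec 2 ] (∀ m n → e [ m ∷ n ∷ [] ]⇓ f m n)

var : ∀ {n} (i : Fin n) → Computableⁿ (λ xs → lookup xs i)
var i = proj i , λ _ → proj⇓

const : ∀ {n} k → Computableⁿ {n} (λ _ → k)
const zero    = comp zer [] , λ _ → comp⇓ []⇓ zer⇓
const (suc k) = let e , e⇓ = const k in comp succ (e ∷ []) , λ xs → comp⇓ (e⇓ xs ∷⇓ []⇓) succ⇓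

app : ∀ {n f} {G : Vec ℕ n → ℕ} → Computable f → Computableⁿ G → Computableⁿ (λ xs → f (G xs))
app (e , e⇓) (g , g⇓) = comp e (g ∷ []) , λ xs → comp⇓ (g⇓ xs ∷⇓ []⇓) (e⇓ _)

app₂ : ∀ {n f} {G H : Vec ℕ n → ℕ} → Computable₂ f → Computableⁿ G → Computableⁿ H →
       Computableⁿ (λ xs → f (G xs) (H xs))
app₂ (e , e⇓) (g , g⇓) (h , h⇓) =
  comp e (g ∷ h ∷ []) , λ xs → comp⇓ (g⇓ xs ∷⇓ (h⇓ xs ∷⇓ []⇓)) (e⇓ _ _)

unary : ∀ {F} → Computableⁿ F → Computable (λ n → F (n ∷ []))
unary (e , e⇓) = e , λ n → e⇓ (n ∷ [])

binary : ∀ {F} → Computableⁿ F → Computable₂ (λ m n → F (m ∷ n ∷ []))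
binary (e , e⇓) = e , λ m n → e⇓ (m ∷ n ∷ [])

-- The function `f` is fixed beforehand and need satisfy the recursion equations only
-- propositionally, so library functions such as `_∸_` can be treated as they stand.
recursion : ∀ {n} {f : ℕ → Vec ℕ n → ℕ} {F G} → Computableⁿ F → Computableⁿ G →
  (∀ xs → F xs ≡ f 0 xs) → (∀ m xs → G (m ∷ f m xs ∷ xs) ≡ f (suc m) xs) →
  Σ[ e ∈ Rec (suc n) ] (∀ m xs → e [ m ∷ xs ]⇓ f m xs)
recursion {f = f} (e , e⇓) (g , g⇓) base step = prec e g , go
  where
  go : ∀ m xs → prec e g [ m ∷ xs ]⇓ f m xs
  go zero    xs = subst (prec e g [ _ ]⇓_) (base xs) (prec⇓₀ (e⇓ xs))
  go (suc m) xs = subst (prec e g [ _ ]⇓_) (step m xs) (prec⇓₊ (go m xs) (g⇓ _))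

recursion₁ : ∀ {f : ℕ → ℕ} {G} → Computableⁿ G →
  (∀ m → G (m ∷ f m ∷ []) ≡ f (suc m)) → Computable f
recursion₁ {f} cG step =
  let e , e⇓ = recursion {f = λ m _ → f m} (const (f 0)) cG (λ _ → refl) λ { m [] → step m }
  in e , λ m → e⇓ m []

recursion₂ : ∀ {f : ℕ → ℕ → ℕ} {F G} → Computableⁿ F → Computableⁿ G →
  (∀ n → F (n ∷ []) ≡ f 0 n) → (∀ m n → G (m ∷ f m n ∷ n ∷ []) ≡ f (suc m) n) → Computable₂ f
recursion₂ {f} cF cG base step =
  let e , e⇓ = recursion {f = λ { m (n ∷ []) → f m n }} cF cG
                 (λ { (n ∷ []) → base n }) (λ { m (n ∷ []) → step m n })
  in e , λ m n → e⇓ m (n ∷ [])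

suc-computable : Computable suc
suc-computable = succ , λ _ → succ⇓

+-computable : Computable₂ ℕ._+_
+-computable = recursion₂ (var 0F) (app suc-computable (var 1F)) (λ _ → refl) (λ _ _ → refl)

*-computable : Computable₂ ℕ._*_
*-computable = recursion₂ (const 0) (app₂ +-computable (var 2F) (var 1F)) (λ _ → refl) (λ _ _ → refl)

pred-computable : Computable ℕ.pred
pred-computable = recursion₁ (var 0F) (λ _ → refl)

∸-computable : Computable₂ ℕ._∸_
∸-computable = binary (app₂ flipped (var 1F) (var 0F))
  where
  -- `prec` recurses on its first argument, whereas iterating the predecessor recurses on the
  -- subtrahend; hence the exchange of arguments.
  flipped : Computable₂ (λ n m → m ℕ.∸ n)
  flipped = recursion₂ (var 0F) (app pred-computable (var 1F)) (λ _ → refl)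
    (λ n m → ℕ.pred[m∸n]≡m∸[1+n] m n)

2^-computable : Computable (2 ℕ.^_)
2^-computable = recursion₁ (app₂ *-computable (const 2) (var 1F)) (λ _ → refl)

-- Induction on the known zero, shifting `P` by one. The values below the least zero are given as
-- successors because `mu⇓` asks for them in this form.
leastZero : (P : ℕ → ℕ) → ∀ y → P y ≡ 0 →
            ∃[ y ] (P y ≡ 0 × (∀ z → z ℕ.< y → ∃[ w ] P z ≡ suc w))
leastZero P zero    p = 0 , p , λ _ ()
leastZero P (suc y) p with P 0 in eq
... | zero  = 0 , eq , λ _ ()
... | suc w = let y′ , q , below = leastZero (λ z → P (suc z)) y p
              in suc y′ , q , λ { zero _ → w , eq ; (suc z) (ℕ.s≤s z<) → below z z< }

-- The program `mu e` searches upwards from 0 and never consults `z`, which only certifies that the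
-- search ends. So `z` may come from convergence data with no computable content.
minimisation : ∀ {n} {F : Vec ℕ (suc n) → ℕ} → Computableⁿ F →
  (z : Vec ℕ n → ℕ) (Fz≡0 : ∀ xs → F (z xs ∷ xs) ≡ 0) →
  Computableⁿ (λ xs → proj₁ (leastZero (λ y → F (y ∷ xs)) (z xs) (Fz≡0 xs)))
minimisation {F = F} (e , e⇓) z Fz≡0 = mu e , λ xs →
  let y , Fy≡0 , below = leastZero (λ y → F (y ∷ xs)) (z xs) (Fz≡0 xs)
  in mu⇓ (λ y′ y′<y → let w , eq = below y′ y′<y in w , subst (e [ y′ ∷ xs ]⇓_) eq (e⇓ (y′ ∷ xs)))
         (subst (e [ y ∷ xs ]⇓_) Fy≡0 (e⇓ (y ∷ xs)))

-- Increasing functions on ℕ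

increasing-mono : ∀ {g} → Increasing g → ∀ {m n} → m ℕ.≤ n → g m ℕ.≤ g n
increasing-mono {g} inc m≤n = go (ℕ.≤⇒≤′ m≤n)
  where
  go : ∀ {m n} → m ℕ.≤′ n → g m ℕ.≤ g n
  go ℕ.≤′-refl     = ℕ.≤-refl
  go (ℕ.≤′-step p) = ℕ.≤-trans (go p) (ℕ.<⇒≤ (inc _))

increasing-strictMono : ∀ {g} → Increasing g → ∀ {m n} → m ℕ.< n → g m ℕ.< g n
increasing-strictMono inc m<n = ℕ.<-≤-trans (inc _) (increasing-mono inc m<n)

increasing-≥id : ∀ {g} → Increasing g → ∀ n → n ℕ.≤ g n
increasing-≥id inc zero    = ℕ.z≤n
increasing-≥id inc (suc n) = ℕ.≤-<-trans (increasing-≥id inc n) (inc n)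

-- Descend from `m`, where `m < g (suc m)` because `g` dominates the identity, to the first `b` with
-- `g b ≤ m`. Monotonicity and `g a ≤ m` then exclude `b < a`.
bracket : ∀ {g} → Increasing g → ∀ a m → g a ℕ.≤ m →
          ∃[ n ] (a ℕ.≤ n × g n ℕ.≤ m × m ℕ.< g (suc n))
bracket {g} inc a m ga≤m = go m (increasing-≥id inc (suc m))
  where
  go : ∀ b → m ℕ.< g (suc b) → ∃[ n ] (a ℕ.≤ n × g n ℕ.≤ m × m ℕ.< g (suc n))
  go b m<g with g b ℕ.≤? m
  go b m<g | yes gb≤m = b , ℕ.≮⇒≥ (λ b<a → ℕ.<⇒≱ m<g (ℕ.≤-trans (increasing-mono inc b<a) ga≤m)) , gb≤m , m<g
  go zero m<g    | no gb≰m = contradiction (ℕ.≤-trans (increasing-mono inc ℕ.z≤n) ga≤m) gb≰m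
  go (suc b) m<g | no gb≰m = go b (ℕ.≰⇒> gb≰m)

-- The closed form is k + 1 + f(0) + ... + f(k). The added units make it strictly increasing and
-- larger than k, even if the modulus `f` is neither.
majorant : (ℕ → ℕ) → ℕ → ℕ
majorant f zero    = suc (f 0)
majorant f (suc k) = suc (majorant f k ℕ.+ f (suc k))

majorant-computable : ∀ {f} → Computable f → Computable (majorant f)
majorant-computable cf = recursion₁
  (app suc-computable (app₂ +-computable (var 1F) (app cf (app suc-computable (var 0F))))) (λ _ → refl)

majorant-increasing : ∀ f → Increasing (majorant f)
majorant-increasing f k = ℕ.s≤s (ℕ.m≤m+n (majorant f k) (f (suc k)))

majorant-> : ∀ f k → k ℕ.< majorant f k
majorant-> f zero    = ℕ.s≤s ℕ.z≤n
majorant-> f (suc k) = ℕ.≤-<-trans (majorant-> f k) (majorant-increasing f k)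

majorant-≥ : ∀ f k → f k ℕ.≤ majorant f k
majorant-≥ f zero    = ℕ.n≤1+n _
majorant-≥ f (suc k) = ℕ.m≤n⇒m≤1+n (ℕ.m≤n+m _ (majorant f k))

-- Rational estimates

toℚᵘ-/ : ∀ i n → toℚᵘ (i / suc n) ℚᵘ.≃ mkℚᵘ i n
toℚᵘ-/ i n = toℚᵘ-fromℚᵘ (mkℚᵘ i n)

unit-* : ∀ m n .{{_ : NonZero m}} .{{_ : NonZero n}} .{{_ : NonZero (m ℕ.* n)}} →
         + 1 / (m ℕ.* n) ≡ (+ 1 / m) * (+ 1 / n)
unit-* (suc m) (suc n) = toℚᵘ-injective (ℚᵘ.≃-trans (toℚᵘ-/ (+ 1) (n ℕ.+ m ℕ.* suc n))
  (ℚᵘ.≃-sym (ℚᵘ.≃-trans (toℚᵘ-homo-* (+ 1 / suc m) (+ 1 / suc n))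
    (ℚᵘ.*-cong (toℚᵘ-/ (+ 1) m) (toℚᵘ-/ (+ 1) n)))))

-- A positive fraction has numerator at least 1, so it is at least the reciprocal of its
-- denominator.
unit-≤ : ∀ p .{{_ : Positive p}} d .{{_ : NonZero d}} → ↧ₙ p ℕ.≤ d → + 1 / d ≤ p
unit-≤ p@(mkℚ +[1+ n ] q _) (suc d) q≤d = toℚᵘ-cancel-≤ (ℚᵘ.≤-respˡ-≃ (ℚᵘ.≃-sym (toℚᵘ-/ (+ 1) d))
  (ℚᵘ.*≤* (subst₂ ℤ._≤_ (ℤ.pos-* 1 (suc q)) (ℤ.pos-* (suc n) (suc d))
    (ℤ.+≤+ (ℕ.*-mono-≤ (ℕ.s≤s (ℕ.z≤n {n})) q≤d)))))

-- Written exactly as the rational inside `2^-`, so that bounds in `ℝ` against `2^- n` unfold to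
-- bounds against `2⁻ n`.
2⁻ : ℕ → ℚ
2⁻ n = (+ 1 / 2 ℕ.^ n) {{ℕ.m^n≢0 2 n}}

2⁻-pos : ∀ n → 0ℚ < 2⁻ n
2⁻-pos n = positive⁻¹ (2⁻ n) {{normalize-pos 1 (2 ℕ.^ n) {{ℕ.m^n≢0 2 n}}}}

2⁻-+ : ∀ m n → 2⁻ (m ℕ.+ n) ≡ 2⁻ m * 2⁻ n
2⁻-+ m n = trans
  (/-cong {p₁ = + 1} {{ℕ.m^n≢0 2 (m ℕ.+ n)}} {{nz}} refl (ℕ.^-distribˡ-+-* 2 m n))
  (unit-* (2 ℕ.^ m) (2 ℕ.^ n) {{ℕ.m^n≢0 2 m}} {{ℕ.m^n≢0 2 n}} {{nz}})
  where
  nz : NonZero (2 ℕ.^ m ℕ.* 2 ℕ.^ n)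
  nz = ℕ.m*n≢0 _ _ {{ℕ.m^n≢0 2 m}} {{ℕ.m^n≢0 2 n}}

n≤2^n : ∀ n → n ℕ.≤ 2 ℕ.^ n
n≤2^n zero    = ℕ.z≤n
n≤2^n (suc n) = ℕ.+-mono-≤ {1} (ℕ.m^n>0 2 n) (ℕ.≤-trans (n≤2^n n) (ℕ.m≤m+n _ 0))

2⁻-archimedean : ∀ {p} → 0ℚ < p → ∃[ c ] 2⁻ c ≤ p
2⁻-archimedean {p} 0<p = ↧ₙ p ,
  unit-≤ p {{positive 0<p}} (2 ℕ.^ ↧ₙ p) {{ℕ.m^n≢0 2 (↧ₙ p)}} (n≤2^n (↧ₙ p))

2⁻-anti : ∀ {m n} → m ℕ.≤ n → 2⁻ n ≤ 2⁻ m
2⁻-anti m≤n = go (ℕ.≤⇒≤′ m≤n)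
  where
  ½≤1 : ½ ≤ 1ℚ
  ½≤1 = *≤* (ℤ.+≤+ (ℕ.s≤s ℕ.z≤n))

  go : ∀ {m n} → m ℕ.≤′ n → 2⁻ n ≤ 2⁻ m
  go ℕ.≤′-refl           = ≤-refl
  go (ℕ.≤′-step {n = n} p) = ≤-trans
    (subst₂ _≤_ (sym (2⁻-+ 1 n)) (*-identityˡ (2⁻ n))
      (*-monoʳ-≤-nonNeg (2⁻ n) {{nonNegative (<⇒≤ (2⁻-pos n))}} ½≤1))
    (go p)

+-cancelʳ : ∀ p b → p + b - b ≡ p
+-cancelʳ p b = solve 2 (λ p b → p :+ b :- b := p) refl p b
  where open +-*-Solver

-- A linear consequence q − p = b − a of a < b, with the identity stated
-- without subtraction.
<-lin : ∀ {a b p q} → a < b → p + b ≡ q + a → p < q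
<-lin {a} {b} {p} {q} a<b eq = subst₂ _<_ (+-cancelʳ p b) (+-cancelʳ q b)
  (+-monoˡ-< (- b) (subst (_< q + b) (sym eq) (+-monoʳ-< q a<b)))

≤-lin : ∀ {a b p q} → a ≤ b → p + b ≡ q + a → p ≤ q
≤-lin {a} {b} {p} {q} a≤b eq = subst₂ _≤_ (+-cancelʳ p b) (+-cancelʳ q b)
  (+-monoˡ-≤ (- b) (subst (_≤ q + b) (sym eq) (+-monoʳ-≤ q a≤b)))

-- Comparison of fractions by natural-number arithmetic

-- (a − b)/(c+1) < (a′ − b′)/(c′+1) + 1/d amounts to lhs < rhs: denominators are
-- cleared and the negative terms (together: shift) moved to the other side.
module Comparison (a b c a′ b′ c′ d : ℕ) where
  lhs rhs : ℕ
  lhs = a ℕ.* (suc c′ ℕ.* d) ℕ.+ b′ ℕ.* d ℕ.* suc c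
  rhs = (a′ ℕ.* d ℕ.+ suc c′) ℕ.* suc c ℕ.+ b ℕ.* (suc c′ ℕ.* d)

  K = + (suc c′ ℕ.* d)
  shift = + b ℤ.* K ℤ.+ + b′ ℤ.* + d ℤ.* + suc c
  -- `u` and `v` are the two cross-products that the order on unnormalised rationals compares.
  u = (a ⊖ b) ℤ.* K
  v = ((a′ ⊖ b′) ℤ.* + d ℤ.+ + 1 ℤ.* + suc c′) ℤ.* + suc c

  open ℤSolver.+-*-Solver

  u+shift : u ℤ.+ shift ≡ + lhs
  u+shift = trans (cong (λ i → i ℤ.* K ℤ.+ shift) (sym (ℤ.m-n≡m⊖n a b))) (trans
    (solve 4 (λ a b k z → (a :- b) :* k :+ (b :* k :+ z) := a :* k :+ z) refl
      (+ a) (+ b) K (+ b′ ℤ.* + d ℤ.* + suc c))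
    (sym (cong₂ ℤ._+_ (ℤ.pos-* a (suc c′ ℕ.* d))
      (trans (ℤ.pos-* (b′ ℕ.* d) (suc c)) (cong (ℤ._* + suc c) (ℤ.pos-* b′ d))))))

  v+shift : v ℤ.+ shift ≡ + rhs
  v+shift = trans
    (cong (λ i → (i ℤ.* + d ℤ.+ + 1 ℤ.* + suc c′) ℤ.* + suc c ℤ.+ shift) (sym (ℤ.m-n≡m⊖n a′ b′))) (trans
    (solve 6 (λ a b k c c′ d → ((a :- b) :* d :+ con (+ 1) :* c′) :* c :+ (k :+ b :* d :* c)
                                := (a :* d :+ c′) :* c :+ k) refl
      (+ a′) (+ b′) (+ b ℤ.* K) (+ suc c) (+ suc c′) (+ d))
    (sym (cong₂ ℤ._+_
      (trans (ℤ.pos-* (a′ ℕ.* d ℕ.+ suc c′) (suc c)) (cong (λ i → (i ℤ.+ + suc c′) ℤ.* + suc c) (ℤ.pos-* a′ d)))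
      (ℤ.pos-* b (suc c′ ℕ.* d)))))

  unshift : ∀ i → i ℤ.+ shift ℤ.- shift ≡ i
  unshift i = solve 2 (λ i z → i :+ z :- z := i) refl i shift

  u<v⇒ : u ℤ.< v → lhs ℕ.< rhs
  u<v⇒ u<v = ℤ.drop‿+<+ (subst₂ ℤ._<_ u+shift v+shift (ℤ.+-monoˡ-< shift u<v))

  u<v⇐ : lhs ℕ.< rhs → u ℤ.< v
  u<v⇐ l<r = subst₂ ℤ._<_ (unshift u) (unshift v)
    (ℤ.+-monoˡ-< (ℤ.- shift) (subst₂ ℤ._<_ (sym u+shift) (sym v+shift) (ℤ.+<+ l<r)))

open Comparison using (lhs; rhs)

module _ (a b c a′ b′ c′ : ℕ) where
  private
    toℚᵘ-sum : ∀ d → toℚᵘ ((a′ ⊖ b′) / suc c′ + + 1 / suc d) ℚᵘ.≃ mkℚᵘ (a′ ⊖ b′) c′ ℚᵘ.+ mkℚᵘ (+ 1) d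
    toℚᵘ-sum d = ℚᵘ.≃-trans (toℚᵘ-homo-+ ((a′ ⊖ b′) / suc c′) (+ 1 / suc d))
      (ℚᵘ.+-cong (toℚᵘ-/ (a′ ⊖ b′) c′) (toℚᵘ-/ (+ 1) d))

  /-<⇒ : ∀ d .{{_ : NonZero d}} → (a ⊖ b) / suc c < (a′ ⊖ b′) / suc c′ + + 1 / d →
         lhs a b c a′ b′ c′ d ℕ.< rhs a b c a′ b′ c′ d
  /-<⇒ (suc d) h
    with ℚᵘ.<-respˡ-≃ (toℚᵘ-/ (a ⊖ b) c) (ℚᵘ.<-respʳ-≃ (toℚᵘ-sum d) (toℚᵘ-mono-< h))
  ... | ℚᵘ.*<* u<v = Comparison.u<v⇒ a b c a′ b′ c′ (suc d) u<v

  /-<⇐ : ∀ d .{{_ : NonZero d}} → lhs a b c a′ b′ c′ d ℕ.< rhs a b c a′ b′ c′ d →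
         (a ⊖ b) / suc c < (a′ ⊖ b′) / suc c′ + + 1 / d
  /-<⇐ (suc d) l<r = toℚᵘ-cancel-<
    (ℚᵘ.<-respˡ-≃ (ℚᵘ.≃-sym (toℚᵘ-/ (a ⊖ b) c)) (ℚᵘ.<-respʳ-≃ (ℚᵘ.≃-sym (toℚᵘ-sum d))
      (ℚᵘ.*<* (Comparison.u<v⇐ a b c a′ b′ c′ (suc d) l<r))))

-- Approximations

-- Two one-sided inequalities in place of an absolute value: for ε = 1/d each has the form treated
-- in `Comparison`.
Near : ℚ → ℚ → ℚ → Set
Near ε p q = p < q + ε × q < p + ε

near-weaken : ∀ {ε δ p q} → ε ≤ δ → Near ε p q → Near δ p q
near-weaken {p = p} {q} ε≤δ (p<q , q<p) =
  <-≤-trans p<q (+-monoʳ-≤ q ε≤δ) , <-≤-trans q<p (+-monoʳ-≤ p ε≤δ)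

near-via : ∀ {ε p q r} → Near (½ * ε) p r → Near (½ * ε) q r → Near ε p q
near-via {ε} {p} {q} {r} (p<r , r<p) (q<r , r<q) = add p q p<r r<q , add q p q<r r<p
  where
  open +-*-Solver
  add : ∀ p q → p < r + ½ * ε → r < q + ½ * ε → p < q + ε
  add p q p<r r<q = <-lin (+-mono-< p<r r<q)
    (solve 4 (λ p q r ε → p :+ ((r :+ con ½ :* ε) :+ (q :+ con ½ :* ε)) := (q :+ ε) :+ (p :+ r)) refl p q r ε)

<-from-∣-∣ : ∀ {ε p q} → ∣ p - q ∣ < ε → p < q + ε
<-from-∣-∣ {ε} {p} {q} h = <-lin (≤-<-trans (≤∣∣ (p - q)) h)
  (solve 3 (λ p q ε → p :+ ε := (q :+ ε) :+ (p :- q)) refl p q ε)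
  where open +-*-Solver

near-from-∣-∣ : ∀ {ε p q} → ∣ p - q ∣ < ε → Near ε p q
near-from-∣-∣ {ε} {p} {q} h = <-from-∣-∣ h , <-from-∣-∣ (subst (_< ε) (∣-∣-comm p q) h)

<-from-+≤ : ∀ {p q δ} → 0ℚ < δ → p + δ ≤ q → p < q
<-from-+≤ {p} 0<δ h = <-≤-trans (subst (_< p + _) (+-identityʳ p) (+-monoʳ-< p 0<δ)) h

fromℚ-pos : ∀ {ε} → 0ℚ < ε → 0ᵣ <ᵣ fromℚ ε
fromℚ-pos {ε} 0<ε = ε , 0<ε , 0 , λ _ _ → ≤-reflexive (+-identityˡ ε)

converges-near : ∀ {xs l} → ConvergesTo ⟦ xs ⟧ l → ∀ {ε} → 0ℚ < ε →
  ∃[ N ] (∀ n → N ℕ.≤ n → ∃[ M ] (∀ k → M ℕ.≤ k → Near ε (xs n) (seq l k)))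
converges-near {xs} {l} conv {ε} 0<ε =
  let N , close = conv (fromℚ ε) (fromℚ-pos 0<ε)
  in N , λ n N≤n → let δ , 0<δ , M , h = close n N≤n in
    M , λ k M≤k → near-from-∣-∣ (subst (_< ε) (∣-∣-comm (seq l k) (xs n)) (<-from-+≤ 0<δ (h k M≤k)))

-- Both terms are compared with one late rational of the sequence representing `l`.
common-limit-near : ∀ {xs ys l} → ConvergesTo ⟦ xs ⟧ l → ConvergesTo ⟦ ys ⟧ l → ∀ {ε} → 0ℚ < ε →
  ∃[ N ] (∀ n → N ℕ.≤ n → Near ε (xs n) (ys n))
common-limit-near {xs} {ys} {l} xs→l ys→l 0<ε =
  let N , p = converges-near {xs} {l} xs→l (half-pos 0<ε)
      N′ , q = converges-near {ys} {l} ys→l (half-pos 0<ε)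
  in N ℕ.⊔ N′ , λ n ≤n →
    let M , near = p n (ℕ.m⊔n≤o⇒m≤o N N′ ≤n)
        M′ , near′ = q n (ℕ.m⊔n≤o⇒n≤o N N′ ≤n)
    in near-via (near (M ℕ.⊔ M′) (ℕ.m≤m⊔n M M′)) (near′ (M ℕ.⊔ M′) (ℕ.m≤n⊔m M M′))

-- A computable subsequence of indices at which two sequences are close

-- The quantity whose vanishing is the inequality decided in Comparison.
deficit : ℕ → ℕ → ℕ → ℕ → ℕ → ℕ → ℕ → ℕ
deficit a b c a′ b′ c′ d = suc (lhs a b c a′ b′ c′ d) ℕ.∸ rhs a b c a′ b′ c′ d

deficit-computable : ∀ {n} {a b c a′ b′ c′ d : Vec ℕ n → ℕ} →
  Computableⁿ a → Computableⁿ b → Computableⁿ c →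
  Computableⁿ a′ → Computableⁿ b′ → Computableⁿ c′ → Computableⁿ d →
  Computableⁿ (λ xs → deficit (a xs) (b xs) (c xs) (a′ xs) (b′ xs) (c′ xs) (d xs))
deficit-computable a b c a′ b′ c′ d =
  app₂ ∸-computable
    (s ((a ⊗ (s c′ ⊗ d)) ⊕ ((b′ ⊗ d) ⊗ s c)))
    ((((a′ ⊗ d) ⊕ s c′) ⊗ s c) ⊕ (b ⊗ (s c′ ⊗ d)))
  where
  s = λ {n} {G : Vec ℕ n → ℕ} → app {G = G} suc-computable
  _⊕_ = λ {n} {G H : Vec ℕ n → ℕ} → app₂ {G = G} {H} +-computable
  _⊗_ = λ {n} {G H : Vec ℕ n → ℕ} → app₂ {G = G} {H} *-computable

module CloseSubsequence {xs ys : ℕ → ℚ} (cxs : Computableℚ xs) (cys : Computableℚ ys)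
  (near : ∀ n p → ∃[ t ] (p ℕ.< t × Near (2⁻ n) (xs t) (ys t))) where

  private
    a  = proj₁ cxs
    b  = proj₁ (proj₂ cxs)
    c  = proj₁ (proj₂ (proj₂ cxs))
    a′ = proj₁ cys
    b′ = proj₁ (proj₂ cys)
    c′ = proj₁ (proj₂ (proj₂ cys))

    -- Conjunction is coded as addition, since a sum of natural numbers is zero exactly when both
    -- summands are. `obstacle` adjoins the condition `p < t` in the same way.
    gap : ℕ → ℕ → ℕ
    gap t d = deficit (a t) (b t) (c t) (a′ t) (b′ t) (c′ t) d
        ℕ.+ deficit (a′ t) (b′ t) (c′ t) (a t) (b t) (c t) d

    gap-computable : Computable₂ gap
    gap-computable =
      let _ , _ , _ , ca  , cb  , cc  , _ = cxs
          _ , _ , _ , ca′ , cb′ , cc′ , _ = cys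
          t = var 0F ; d = var 1F
      in binary (app₂ +-computable
        (deficit-computable (app ca t) (app cb t) (app cc t) (app ca′ t) (app cb′ t) (app cc′ t) d)
        (deficit-computable (app ca′ t) (app cb′ t) (app cc′ t) (app ca t) (app cb t) (app cc t) d))

    xs≡ : ∀ t → xs t ≡ (a t ⊖ b t) / suc (c t)
    xs≡ = let _ , _ , _ , _ , _ , _ , eq = cxs in eq

    ys≡ : ∀ t → ys t ≡ (a′ t ⊖ b′ t) / suc (c′ t)
    ys≡ = let _ , _ , _ , _ , _ , _ , eq = cys in eq

    near⇒gap≡0 : ∀ t n → Near (2⁻ n) (xs t) (ys t) → gap t (2 ℕ.^ n) ≡ 0
    near⇒gap≡0 t n x~y with subst₂ (Near (2⁻ n)) (xs≡ t) (ys≡ t) x~y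
    ... | x<y , y<x = cong₂ ℕ._+_
      (ℕ.m≤n⇒m∸n≡0 (/-<⇒ (a t) (b t) (c t) (a′ t) (b′ t) (c′ t) (2 ℕ.^ n) {{ℕ.m^n≢0 2 n}} x<y))
      (ℕ.m≤n⇒m∸n≡0 (/-<⇒ (a′ t) (b′ t) (c′ t) (a t) (b t) (c t) (2 ℕ.^ n) {{ℕ.m^n≢0 2 n}} y<x))

    gap≡0⇒near : ∀ t n → gap t (2 ℕ.^ n) ≡ 0 → Near (2⁻ n) (xs t) (ys t)
    gap≡0⇒near t n eq = subst₂ (Near (2⁻ n)) (sym (xs≡ t)) (sym (ys≡ t))
      ( /-<⇐ (a t) (b t) (c t) (a′ t) (b′ t) (c′ t) (2 ℕ.^ n) {{ℕ.m^n≢0 2 n}}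
          (ℕ.m∸n≡0⇒m≤n (ℕ.m+n≡0⇒m≡0 _ eq))
      , /-<⇐ (a′ t) (b′ t) (c′ t) (a t) (b t) (c t) (2 ℕ.^ n) {{ℕ.m^n≢0 2 n}}
          (ℕ.m∸n≡0⇒m≤n (ℕ.m+n≡0⇒n≡0 (deficit (a t) (b t) (c t) (a′ t) (b′ t) (c′ t) (2 ℕ.^ n)) eq)))

    obstacle : ℕ → ℕ → ℕ → ℕ
    obstacle n p t = (suc p ℕ.∸ t) ℕ.+ gap t (2 ℕ.^ n)

    obstacle-free : ∀ n p → obstacle n p (proj₁ (near n p)) ≡ 0
    obstacle-free n p = let t , p<t , x~y = near n p in
      cong₂ ℕ._+_ (ℕ.m≤n⇒m∸n≡0 p<t) (near⇒gap≡0 t n x~y)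

    next-spec : ∀ n p → ∃[ t ] (obstacle n p t ≡ 0 × (∀ z → z ℕ.< t → ∃[ w ] obstacle n p z ≡ suc w))
    next-spec n p = leastZero (obstacle n p) (proj₁ (near n p)) (obstacle-free n p)

    next-computable : Computableⁿ (λ (xs : Vec ℕ 2) → proj₁ (next-spec (lookup xs 0F) (lookup xs 1F)))
    next-computable = minimisation
      (app₂ +-computable
        (app₂ ∸-computable (app suc-computable (var 2F)) (var 0F))
        (app₂ gap-computable (var 0F) (app 2^-computable (var 1F))))
      (λ xs → proj₁ (near (lookup xs 0F) (lookup xs 1F)))
      (λ xs → obstacle-free (lookup xs 0F) (lookup xs 1F))

  index : ℕ → ℕ
  -- The starting index carries no closeness, so `index-near` speaks of successors only and its
  -- tolerance lags by one.
  index zero    = 0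
  index (suc n) = proj₁ (next-spec n (index n))

  index-computable : Computable index
  index-computable = recursion₁ next-computable (λ _ → refl)

  index-increasing : Increasing index
  index-increasing n = let _ , eq , _ = next-spec n (index n) in
    ℕ.m∸n≡0⇒m≤n (ℕ.m+n≡0⇒m≡0 _ eq)

  index-near : ∀ n → Near (2⁻ n) (xs (index (suc n))) (ys (index (suc n)))
  index-near n = let _ , eq , _ = next-spec n (index n) in
    gap≡0⇒near (index (suc n)) n (ℕ.m+n≡0⇒n≡0 (suc (index n) ℕ.∸ index (suc n)) eq)

closeSubsequence : ∀ {xs ys} → Computableℚ xs → Computableℚ ys →
  (∀ n p → ∃[ t ] (p ℕ.< t × Near (2⁻ n) (xs t) (ys t))) →
  Σ[ t ∈ (ℕ → ℕ) ] (Computable t × Increasing t ×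
    (∀ n → Near (2⁻ n) (xs (t (suc n))) (ys (t (suc n)))))
closeSubsequence cxs cys near = index , index-computable , index-increasing , index-near
  where open CloseSubsequence cxs cys near

-- Progress made at a fast stage

≤ᵣ⇒eventually : ∀ u v → u ≤ᵣ v → ∀ {ε} → 0ℚ < ε → ∃[ N ] (∀ k → N ℕ.≤ k → seq u k ≤ seq v k + ε)
≤ᵣ⇒eventually u v u≤v {ε} 0<ε = N , bound
  where
  open +-*-Solver
  w = seq (u -ᵣ v)
  η = ½ * ε
  0<η = half-pos 0<ε
  N = proj₁ (cauchy (u -ᵣ v) (½ * η) (half-pos 0<η))
  osc = proj₂ (cauchy (u -ᵣ v) (½ * η) (half-pos 0<η))

  -- A single rational comparison is decidable. If `w N` exceeded η, then `w` would stay above η/2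
  -- from `N` on, giving `v <ᵣ u` against `u ≤ᵣ v`.
  wN≤η : w N ≤ η
  wN≤η with w N ≤? η
  ... | yes h = h
  ... | no  h = contradiction (½ * η , half-pos 0<η , N , λ k N≤k → <⇒≤
    (<-lin (+-mono-< (≰⇒> h) (<-from-∣-∣ {½ * η} {w N} {w k} (osc N k ℕ.≤-refl N≤k)))
      (solve 4 (λ u v w η → (v :+ con ½ :* η) :+ (w :+ ((u :- v) :+ con ½ :* η)) := u :+ (η :+ w)) refl
        (seq u k) (seq v k) (w N) η))) u≤v

  bound : ∀ k → N ℕ.≤ k → seq u k ≤ seq v k + ε
  bound k N≤k = <⇒≤ (<-lin
    (+-mono-≤-< (+-mono-≤ wN≤η (<⇒≤ (half-pos 0<η)))
      (<-from-∣-∣ {½ * η} {w k} {w N} (osc k N N≤k ℕ.≤-refl)))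
    (solve 4 (λ u v w ε → u :+ ((con ½ :* ε :+ con ½ :* (con ½ :* ε)) :+ (w :+ con ½ :* (con ½ :* ε)))
                           := (v :+ ε) :+ ((w :+ con 0ℚ) :+ (u :- v))) refl
      (seq u k) (seq v k) (w N) ε))

module _ {x : ℝ} {xs : ℕ → ℚ} (inc : StrictlyIncreasingℚ xs) (conv : ConvergesTo ⟦ xs ⟧ x) where

  -- Put A = x - x_{m+1} and B = x - x_m. From A/B ≤ ρ + σ and ρ + 2σ ≤ 1 follows A + σB ≤ B, and B
  -- - A is the step of the sequence. One σ pays for passing from `≤ᵣ` to rationals, the other is
  -- the gain.
  gain : ∀ {ρ σ N} → 0ℚ < σ → (∀ k → N ℕ.≤ k → seq ρ k + (σ + σ) ≤ 1ℚ) → ∀ m →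
    divide (x -ᵣ fromℚ (xs (suc m))) (x -ᵣ fromℚ (xs m)) (0<limit-term xs {x} inc conv m) ≤ᵣ ρ →
    ∃[ K ] (∀ k → K ℕ.≤ k → σ * (seq x k - xs m) ≤ xs (suc m) - xs m)
  gain {ρ} {σ} {N} 0<σ ρ+2σ≤1 m q≤ρ =
    let δ , 0<δ , M , δ≤ = 0<limit-term xs {x} inc conv m
        L , q≤ρ+σ = ≤ᵣ⇒eventually
          (divide (x -ᵣ fromℚ (xs (suc m))) (x -ᵣ fromℚ (xs m)) (0<limit-term xs {x} inc conv m)) ρ q≤ρ 0<σ
    in N ℕ.⊔ (M ℕ.⊔ L) , λ k ≤k →
      let ≤k′ = ℕ.m⊔n≤o⇒n≤o N (M ℕ.⊔ L) ≤k
      in estimate (seq x k) (seq ρ k)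
        (<-≤-trans (subst (0ℚ <_) (sym (+-identityˡ δ)) 0<δ) (δ≤ k (ℕ.m⊔n≤o⇒m≤o M L ≤k′)))
        (q≤ρ+σ k (ℕ.m⊔n≤o⇒n≤o M L ≤k′))
        (ρ+2σ≤1 k (ℕ.m⊔n≤o⇒m≤o N (M ℕ.⊔ L) ≤k))
    where
    open +-*-Solver
    estimate : ∀ X R → 0ℚ < X - xs m → (X - xs (suc m)) * inv (X - xs m) ≤ R + σ → R + (σ + σ) ≤ 1ℚ →
               σ * (X - xs m) ≤ xs (suc m) - xs m
    estimate X R 0<B q≤R+σ R+2σ≤1 = ≤-lin (*-monoʳ-≤-nonNeg B {{nonNegative (<⇒≤ 0<B)}} q+σ≤1)
      (trans
        (solve 4 (λ s X y z → s :* (X :- y) :+ con 1ℚ :* (X :- y)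
                     := (z :- y) :+ ((X :- z) :* con 1ℚ :+ s :* (X :- y))) refl σ X (xs m) (xs (suc m)))
        (cong (λ r → (xs (suc m) - xs m) + r) (trans
          (cong (λ r → A * r + σ * B) (sym (inv-inverse 0<B)))
          (solve 4 (λ a i b s → a :* (i :* b) :+ s :* b := (a :* i :+ s) :* b) refl A (inv B) B σ))))
      where
      A = X - xs (suc m)
      B = X - xs m
      q+σ≤1 : A * inv B + σ ≤ 1ℚ
      q+σ≤1 = ≤-lin (+-mono-≤ q≤R+σ R+2σ≤1)
        (solve 3 (λ q s R → (q :+ s) :+ ((R :+ s) :+ con 1ℚ) := con 1ℚ :+ (q :+ (R :+ (s :+ s)))) refl (A * inv B) σ R)

-- The regaining subsequence

strictlyIncreasing⇒mono : ∀ {xs} → StrictlyIncreasingℚ xs → ∀ {m n} → m ℕ.≤ n → xs m ≤ xs n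
strictlyIncreasing⇒mono {xs} inc {m} {n} m≤n =
  subst (λ i → xs m ≤ xs i) (ℕ.m∸n+n≡m m≤n) (monotone {xs} inc m (n ℕ.∸ m))

-- One ε bounds the jump of y, and exchanging y for x costs one more at each endpoint.
jump-bound : ∀ {ε x x′ y y′} → Near ε x y → Near ε x′ y′ → ∣ 0ℚ - (y′ - y) ∣ < ε → x′ - x ≤ ε + ε + ε
jump-bound {ε} {x} {x′} {y} {y′} (_ , y<x) (x′<y′ , _) Δy = <⇒≤ (<-lin
  (+-mono-< (+-mono-< y<x x′<y′) (<-from-∣-∣ {ε} {y′ - y} {0ℚ} (subst (_< ε) (∣-∣-comm 0ℚ (y′ - y)) Δy)))
  (solve 5 (λ e x x′ y y′ → (x′ :- x) :+ (((x :+ e) :+ (y′ :+ e)) :+ (con 0ℚ :+ e))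
                            := (e :+ e :+ e) :+ ((y :+ x′) :+ (y′ :- y))) refl ε x x′ y y′))
  where open +-*-Solver

module Regain {x : ℝ} {xs ys : ℕ → ℚ} (cxs : Computableℚ xs)
  (inc : StrictlyIncreasingℚ xs) (xs→x : ConvergesTo ⟦ xs ⟧ x)
  {t : ℕ → ℕ} (t-computable : Computable t) (t-increasing : Increasing t)
  (t-near : ∀ n → Near (2⁻ n) (xs (t (suc n))) (ys (t (suc n))))
  {f : ℕ → ℕ} (f-computable : Computable f)
  (f-modulus : IsModulus f ⟦ (λ n → ys (t (suc n)) - ys (t n)) ⟧ 0ᵣ)
  {σ : ℚ} (0<σ : 0ℚ < σ) {c : ℕ} (6·2⁻c≤σ : 2⁻ c ≤ + 1 / 6 * σ)
  (speed : InfinitelyMany (λ m → ∃[ K ] (∀ k → K ℕ.≤ k → σ * (seq x k - xs m) ≤ xs (suc m) - xs m)))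
  where

  F = majorant f

  -- For every n < F(j+c+1) this index is at or past the end t(n+1) of the n-th block, so z_j is at
  -- least x_m for each m in that block.
  position : ℕ → ℕ
  position j = t (F (suc (j ℕ.+ c)))

  position-increasing : Increasing position
  position-increasing j = increasing-strictMono t-increasing (majorant-increasing f (suc (j ℕ.+ c)))

  zs : ℕ → ℚ
  zs j = xs (position j)

  zs-computable : Computableℚ zs
  zs-computable =
    let a , b , d , ca , cb , cd , eq = cxs
        cp = app t-computable (app (majorant-computable f-computable)
               (app suc-computable (app₂ +-computable (var 0F) (const c))))
    in _ , _ , _ , unary (app ca cp) , unary (app cb cp) , unary (app cd cp) , λ j → eq (position j)

  zs-nonDecreasing : NonDecreasingℚ zs
  zs-nonDecreasing j = strictlyIncreasing⇒mono {xs} inc (ℕ.<⇒≤ (position-increasing j))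

  zs→x : ConvergesTo ⟦ zs ⟧ x
  zs→x ε 0<ε = let N , h = xs→x ε 0<ε in
    N , λ j N≤j → h (position j) (ℕ.≤-trans N≤j (increasing-≥id position-increasing j))

  -- The strict bound k < F(k) matters twice: it excludes n = 0, where `t-near` says nothing, and it
  -- absorbs the lag by one in the tolerance at `t (suc n)`.
  jump : ∀ k n → F k ℕ.≤ n → xs (t (suc n)) - xs (t n) ≤ 2⁻ k + 2⁻ k + 2⁻ k
  jump k zero    Fk≤n = contradiction (ℕ.≤-trans (majorant-> f k) Fk≤n) λ ()
  jump k (suc n) Fk≤n =
    let k≤n = ℕ.s≤s⁻¹ (ℕ.≤-trans (majorant-> f k) Fk≤n)
        δ , 0<δ , M , h = f-modulus k (suc n) (ℕ.≤-trans (majorant-≥ f k) Fk≤n)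
    in jump-bound
      (near-weaken {p = xs (t (suc n))} {ys (t (suc n))} (2⁻-anti k≤n) (t-near n))
      (near-weaken {p = xs (t (suc (suc n)))} {ys (t (suc (suc n)))}
        (2⁻-anti (ℕ.m≤n⇒m≤1+n k≤n)) (t-near (suc n)))
      (<-from-+≤ 0<δ (h M ℕ.≤-refl))

  -- The step at m lies inside the n-th jump, so σ(x - x_m) ≤ 3·2^-(j+c) ≤ σ·2^-j/2. Cancelling σ
  -- and using x_m ≤ z_j bounds x - z_j by 2^-j/2; the other half is the positive room that `<ᵣ`
  -- demands.
  regains-at : ∀ j n m → F (j ℕ.+ c) ℕ.≤ n → n ℕ.< F (suc (j ℕ.+ c)) →
    t n ℕ.≤ m → m ℕ.< t (suc n) →
    ∃[ K ] (∀ k → K ℕ.≤ k → σ * (seq x k - xs m) ≤ xs (suc m) - xs m) →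
    x -ᵣ fromℚ (zs j) <ᵣ 2^- j
  regains-at j n m F≤n n<F i≤m m<i (K , h) =
    ½ * 2⁻ j , half-pos (2⁻-pos j) , K , λ k K≤k → estimate (seq x k) (h k K≤k)
    where
    open +-*-Solver
    -- The factor 6 in the choice of `c` is 3 for the terms of the jump bound times 2 for the halved
    -- target.
    3·2⁻ : 2⁻ (j ℕ.+ c) + 2⁻ (j ℕ.+ c) + 2⁻ (j ℕ.+ c) ≤ σ * (½ * 2⁻ j)
    3·2⁻ = subst₂ _≤_
      (trans (solve 2 (λ p q → (con 1ℚ :+ con 1ℚ :+ con 1ℚ) :* p :* q := p :* q :+ p :* q :+ p :* q) refl (2⁻ j) (2⁻ c))
        (cong (λ r → r + r + r) (sym (2⁻-+ j c))))
      (solve 2 (λ p s → (con 1ℚ :+ con 1ℚ :+ con 1ℚ) :* p :* (con (+ 1 / 6) :* s) := s :* (con ½ :* p)) refl (2⁻ j) σ)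
      (*-monoˡ-≤-nonNeg ((1ℚ + 1ℚ + 1ℚ) * 2⁻ j) {{nonNegative (<⇒≤ (*-pos {1ℚ + 1ℚ + 1ℚ} (positive⁻¹ _) (2⁻-pos j)))}}
        (6·2⁻c≤σ))

    xs-jump : xs (suc m) - xs m ≤ xs (t (suc n)) - xs (t n)
    xs-jump = +-mono-≤ (strictlyIncreasing⇒mono {xs} inc m<i)
      (neg-antimono-≤ (strictlyIncreasing⇒mono {xs} inc i≤m))

    xs-m≤zs : xs m ≤ zs j
    xs-m≤zs = strictlyIncreasing⇒mono {xs} inc
      (ℕ.≤-trans (ℕ.<⇒≤ m<i) (increasing-mono t-increasing n<F))

    estimate : ∀ X → σ * (X - xs m) ≤ xs (suc m) - xs m → (X - zs j) + ½ * 2⁻ j ≤ 2⁻ j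
    estimate X σ≤ = ≤-lin (+-mono-≤ xs-m≤zs
        (*-cancelˡ-≤-pos σ {{positive 0<σ}}
          (≤-trans σ≤ (≤-trans xs-jump (≤-trans (jump (j ℕ.+ c) n F≤n) 3·2⁻)))))
      (solve 4 (λ X z y p → ((X :- z) :+ con ½ :* p) :+ (z :+ con ½ :* p) := p :+ (y :+ (X :- y))) refl
        X (zs j) (xs m) (2⁻ j))

  regaining : InfinitelyMany (λ j → x -ᵣ fromℚ (zs j) <ᵣ 2^- j)
  regaining N =
    -- Starting at `t (F (N + c))` forces k ≥ N + c, so k - c is a genuine difference and at least
    -- N.
    let m , ≤m , fast = speed (t (F (N ℕ.+ c)))
        n , F≤n , t≤m , m<t = bracket t-increasing (F (N ℕ.+ c)) m ≤m
        k , N+c≤k , Fk≤n , n<Fk = bracket (majorant-increasing f) (N ℕ.+ c) n F≤n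
        j+c≡k = ℕ.m∸n+n≡m (ℕ.m+n≤o⇒n≤o N N+c≤k)
    in k ℕ.∸ c , ℕ.m+n≤o⇒m≤o∸n N N+c≤k ,
      regains-at (k ℕ.∸ c) n m
        (subst (λ i → F i ℕ.≤ n) (sym j+c≡k) Fk≤n)
        (subst (λ i → n ℕ.< F (suc i)) (sym j+c≡k) n<Fk)
        t≤m m<t fast

  regaininglyApproximable : RegaininglyApproximable x
  regaininglyApproximable = zs , zs-computable , zs-nonDecreasing , zs→x , regaining

theorem5p8 : (x : ℝ) → Speedable x → NearlyComputable x → RegaininglyApproximable x
theorem5p8 x (_ , ρ , _ , (ε , 0<ε , N₁ , ρ+ε≤1) , xs , cxs , inc , xs→x , speed)
             (ys , cys , ys→x , nearly) =
  let near = λ n p →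
        let N , h = common-limit-near {xs} {ys} {x} xs→x ys→x (2⁻-pos n)
        -- This index is both past `N` and above `p`.
        in N ℕ.+ suc p , ℕ.m≤n+m (suc p) N , h (N ℕ.+ suc p) (ℕ.m≤m+n N (suc p))
      t , ct , t-inc , t-near = closeSubsequence cxs cys near
      -- Near computability is applied with s = t, which is possible because `t` is computable and
      -- increasing.
      _ , f , cf , f-modulus = nearly t ct t-inc
      -- σ is half of the margin ε witnessing ρ < 1, so that ρ + 2σ ≤ 1.
      0<σ = half-pos 0<ε
      c , c≤ = 2⁻-archimedean (*-pos {+ 1 / 6} (positive⁻¹ (+ 1 / 6)) 0<σ)
      ρ+2σ≤1 = λ k N₁≤k → subst (λ r → seq ρ k + r ≤ 1ℚ) (sym (half+half ε)) (ρ+ε≤1 k N₁≤k)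
  in Regain.regaininglyApproximable {x} {xs} {ys} cxs inc xs→x ct t-inc t-near cf f-modulus 0<σ {c} c≤
    λ N → let m , N≤m , fast = speed N
          in m , N≤m , gain {x} {xs} inc xs→x {ρ} {½ * ε} {N₁} 0<σ ρ+2σ≤1 m fast
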